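{- For all integers $k\geq 1$ and $\delta\geq 0$, there are infinitely many (pairwise non-isomorphic) digraphs $G$ with minimum outdegree $\delta$ such that for every function $f:V(G)\to\{1,\dots,k\}$ (that is, every vertex $k$-colouring of $G$, not required to be proper), there is a vertex $v$ of $G$ such that all the out-neighbours of $v$ receive the same colour under $f$.
   Context: Digraphs are finite, with no loops and no parallel arcs (a pair of oppositely directed arcs $uv$ and $vu$ is allowed). -}

module Defs where

open import Data.Fin.Base using (Fin)
open import Data.Fin.Subset using (Subset; _∈_; _∉_; ∣_∣)
open import Data.Nat.Base using (ℕ; _≤_)
open import Data.Product.Base using (Σ-syntax; ∃-syntax; _×_)
open import Function.Bundles using (_↔_; _⇔_; module Inverse)
open import Relation.Binary.PropositionalEquality.Core using (_≡_; _≢_)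
open import Relation.Nullary.Negation.Core using (¬_)

-- There is an arc v → u exactly when u ∈ out v. Since out v is a set there are
-- no parallel arcs, while u ∈ out v and v ∈ out u may both hold.
record Digraph : Set where
  field
    order    : ℕ
    out      : Fin order → Subset order
    loopless : ∀ v → v ∉ out v

  Vertex : Set
  Vertex = Fin order

  outdegree : Vertex → ℕ
  outdegree v = ∣ out v ∣

open Digraph public

-- The minimum is attained, so the digraph without vertices has none.
HasMinOutdegree : Digraph → ℕ → Set
HasMinOutdegree G δ =
  (∀ v → δ ≤ outdegree G v) × (∃[ v ] outdegree G v ≡ δ)

MonochromaticOut : (G : Digraph) {k : ℕ} → (Vertex G → Fin k) → Vertex G → Set
MonochromaticOut G f v = ∀ {u w} → u ∈ out G v → w ∈ out G v → f u ≡ f w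

infix 4 _≅_

_≅_ : Digraph → Digraph → Set
G ≅ H = Σ[ φ ∈ Vertex G ↔ Vertex H ]
  (∀ u v → u ∈ out G v ⇔ Inverse.to φ u ∈ out H (Inverse.to φ v))

InfinitelyManyUpToIso : (Digraph → Set) → Set
InfinitelyManyUpToIso P = Σ[ G ∈ (ℕ → Digraph) ]
  (∀ i → P (G i)) × (∀ i j → i ≢ j → ¬ (G i ≅ G j))

{-# OPTIONS --safe #-}
-- Take a base of n > kδ vertices, and for every subset S of the base one further
-- vertex whose out-neighbourhood is S, or the whole base if S has fewer than δ
-- elements. Join each base vertex to all other vertices. In a k-colouring, some
-- colour class S of the base has at least δ elements, and then the vertex of S is
-- monochromatic. Different n give digraphs of different orders.
module Submission where

open import Data.Bool.Base using (true; false)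
open import Data.Fin.Base using (Fin; zero; suc; _↑ˡ_; _↑ʳ_; splitAt; finToFun; funToFin)
open import Data.Fin.Permutation using (↔⇒≡)
open import Data.Fin.Properties using (_≟_; 2↔Bool; finToFun-funToFin; splitAt-↑ʳ; splitAt⁻¹-↑ˡ; splitAt⁻¹-↑ʳ)
open import Data.Fin.Subset using (Subset; _∈_; _∉_; ∣_∣; ⊤; ⊥; ⁅_⁆; ∁)
open import Data.Fin.Subset.Properties using (∉⊥; ∣⊤∣≡n; ∣⊥∣≡0; ∣⁅x⁆∣≡1; ∣∁p∣≡n∸∣p∣; x∈⁅x⁆; x∈p⇒x∉∁p)
open import Data.Nat.Base using (ℕ; zero; suc; _+_; _*_; _^_; _∸_; _≤_; _<_; _≥_; s≤s)
open import Data.Nat.Properties hiding (_≟_)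
open import Data.Product.Base using (_×_; _,_; ∃-syntax)
open import Data.Sum.Base using (inj₁; inj₂)
open import Data.Vec.Base using ([]; _∷_; _++_; lookup; tabulate)
open import Data.Vec.Properties using (lookup-++ˡ; lookup-++ʳ; []=⇒lookup; lookup⇒[]=; lookup∘tabulate; tabulate∘lookup; tabulate-cong)
open import Function.Base using (_∘_)
open import Function.Bundles using (module Inverse)
open import Relation.Binary.Definitions using (tri<; tri≈; tri>)
open import Relation.Binary.PropositionalEquality
open import Relation.Nullary.Decidable.Core using (does; yes; no)
open import Relation.Nullary.Negation.Core using (contradiction)
open import Defs

open import Algebra.Properties.CommutativeMonoid.Sum +-0-commutativeMonoid
  using (sum; sum-cong-≗; ∑-distrib-+; sum-replicate-zero)

private
  variable
    k m n : ℕ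

∣p++q∣≡∣p∣+∣q∣ : (p : Subset m) (q : Subset n) → ∣ p ++ q ∣ ≡ ∣ p ∣ + ∣ q ∣
∣p++q∣≡∣p∣+∣q∣ []          q = refl
∣p++q∣≡∣p∣+∣q∣ (true  ∷ p) q = cong suc (∣p++q∣≡∣p∣+∣q∣ p q)
∣p++q∣≡∣p∣+∣q∣ (false ∷ p) q = ∣p++q∣≡∣p∣+∣q∣ p q

∣p++⊥∣≡∣p∣ : (p : Subset m) → ∣ p ++ ⊥ {n} ∣ ≡ ∣ p ∣
∣p++⊥∣≡∣p∣ {n = n} p = begin
  ∣ p ++ ⊥ {n} ∣      ≡⟨ ∣p++q∣≡∣p∣+∣q∣ p ⊥ ⟩
  ∣ p ∣ + ∣ ⊥ {n} ∣   ≡⟨ cong (∣ p ∣ +_) (∣⊥∣≡0 n) ⟩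
  ∣ p ∣ + 0           ≡⟨ +-identityʳ ∣ p ∣ ⟩
  ∣ p ∣               ∎
  where open ≡-Reasoning

↑ʳ∉p++⊥ : (p : Subset m) (i : Fin n) → m ↑ʳ i ∉ p ++ ⊥
↑ʳ∉p++⊥ p i i∈ = ∉⊥ (lookup⇒[]= i ⊥ (trans (sym (lookup-++ʳ p ⊥ i)) ([]=⇒lookup i∈)))

∈p++⊥ : (p : Subset m) {x : Fin (m + n)} → x ∈ p ++ ⊥ → ∃[ i ] x ≡ i ↑ˡ n × i ∈ p
∈p++⊥ {m} {n} p {x} x∈ with splitAt m x in eq
... | inj₂ i = contradiction (subst (_∈ p ++ ⊥) (sym (splitAt⁻¹-↑ʳ {m} eq)) x∈) (↑ʳ∉p++⊥ p i)
... | inj₁ i with refl ← splitAt⁻¹-↑ˡ {m} {n} eq =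
  i , refl , lookup⇒[]= i p (trans (sym (lookup-++ˡ p ⊥ i)) ([]=⇒lookup x∈))

fibre : (Fin n → Fin k) → Fin k → Subset n
fibre f c = tabulate λ x → does (f x ≟ c)

∈fibre : (f : Fin n → Fin k) (c : Fin k) {x : Fin n} → x ∈ fibre f c → f x ≡ c
∈fibre f c {x} x∈ with f x ≟ c | trans (sym (lookup∘tabulate (λ y → does (f y ≟ c)) x)) ([]=⇒lookup x∈)
... | yes fx≡c | _ = fx≡c
... | no  _    | ()

∑-indicator : (x : Fin k) → sum (λ c → ∣ does (x ≟ c) ∷ [] ∣) ≡ 1
∑-indicator {suc k} zero    = cong suc (sum-replicate-zero k)
∑-indicator {suc k} (suc x) = ∑-indicator x

∑∣fibre∣≡n : (f : Fin n → Fin k) → sum (λ c → ∣ fibre f c ∣) ≡ n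
∑∣fibre∣≡n {zero}  {k} f = sum-replicate-zero k
∑∣fibre∣≡n {suc n} {k} f = begin
  sum (λ c → ∣ fibre f c ∣)
    ≡⟨ sum-cong-≗ (λ c → ∣p++q∣≡∣p∣+∣q∣ (does (f zero ≟ c) ∷ []) (fibre (f ∘ suc) c)) ⟩
  sum (λ c → ∣ does (f zero ≟ c) ∷ [] ∣ + ∣ fibre (f ∘ suc) c ∣)
    ≡⟨ ∑-distrib-+ (λ c → ∣ does (f zero ≟ c) ∷ [] ∣) (λ c → ∣ fibre (f ∘ suc) c ∣) ⟩
  sum (λ c → ∣ does (f zero ≟ c) ∷ [] ∣) + sum (λ c → ∣ fibre (f ∘ suc) c ∣)
    ≡⟨ cong₂ _+_ (∑-indicator (f zero)) (∑∣fibre∣≡n (f ∘ suc)) ⟩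
  suc n ∎
  where open ≡-Reasoning

exceeds-average : ∀ d (g : Fin k → ℕ) → k * d < sum g → ∃[ c ] d < g c
exceeds-average {suc k} d g kd<∑ with d <? g zero
... | yes d<g₀ = zero , d<g₀
... | no  d≮g₀ with c , d<gc ← exceeds-average d (g ∘ suc)
                    (+-cancelˡ-< d (k * d) _ (<-≤-trans kd<∑ (+-monoˡ-≤ _ (≮⇒≥ d≮g₀)))) =
  suc c , d<gc

large-fibre : ∀ d (f : Fin n → Fin k) → k * d < n → ∃[ c ] d < ∣ fibre f c ∣
large-fibre d f kd<n = exceeds-average d _ (subst (_ <_) (sym (∑∣fibre∣≡n f)) kd<n)

decode : ∀ n → Fin (2 ^ n) → Subset n
decode n s = tabulate (Inverse.to 2↔Bool ∘ finToFun s)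

encode : Subset n → Fin (2 ^ n)
encode p = funToFin (Inverse.from 2↔Bool ∘ lookup p)

decode-encode : (p : Subset n) → decode n (encode p) ≡ p
decode-encode {n} p = begin
  decode n (encode p)
    ≡⟨ tabulate-cong (λ x → cong (Inverse.to 2↔Bool) (finToFun-funToFin (Inverse.from 2↔Bool ∘ lookup p) x)) ⟩
  tabulate (Inverse.to 2↔Bool ∘ Inverse.from 2↔Bool ∘ lookup p)
    ≡⟨ tabulate-cong (Inverse.strictlyInverseˡ 2↔Bool ∘ lookup p) ⟩
  tabulate (lookup p)
    ≡⟨ tabulate∘lookup p ⟩
  p ∎
  where open ≡-Reasoning

enlarge : ℕ → Subset n → Subset n
enlarge δ p with δ ≤? ∣ p ∣
... | yes _ = p
... | no  _ = ⊤

enlarge-large : ∀ {δ} (p : Subset n) → δ ≤ ∣ p ∣ → enlarge δ p ≡ p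
enlarge-large {δ = δ} p δ≤ with δ ≤? ∣ p ∣
... | yes _  = refl
... | no  δ≰ = contradiction δ≤ δ≰

∣enlarge∣≥ : ∀ {δ} (p : Subset n) → δ ≤ n → δ ≤ ∣ enlarge δ p ∣
∣enlarge∣≥ {n} {δ} p δ≤n with δ ≤? ∣ p ∣
... | yes δ≤ = δ≤
... | no  _  = subst (δ ≤_) (sym (∣⊤∣≡n n)) δ≤n

outNeighbours : ∀ δ n → Fin (n + 2 ^ n) → Subset (n + 2 ^ n)
outNeighbours δ n v with splitAt n v
... | inj₁ _ = ∁ ⁅ v ⁆
... | inj₂ s = enlarge δ (decode n s) ++ ⊥

v∉outNeighbours : ∀ δ n v → v ∉ outNeighbours δ n v
v∉outNeighbours δ n v with splitAt n v in eq
... | inj₁ _ = x∈p⇒x∉∁p (x∈⁅x⁆ v)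
... | inj₂ s with refl ← splitAt⁻¹-↑ʳ {n} eq = ↑ʳ∉p++⊥ (enlarge δ (decode n s)) s

subsetDigraph : ℕ → ℕ → Digraph
subsetDigraph δ n = record
  { order    = n + 2 ^ n
  ; out      = outNeighbours δ n
  ; loopless = v∉outNeighbours δ n
  }

out-encode : ∀ {δ} (p : Subset n) → δ ≤ ∣ p ∣ → out (subsetDigraph δ n) (n ↑ʳ encode p) ≡ p ++ ⊥
out-encode {n} {δ} p δ≤ rewrite splitAt-↑ʳ n (2 ^ n) (encode p) | decode-encode p =
  cong (_++ ⊥) (enlarge-large p δ≤)

outdegree-encode : ∀ {δ} (p : Subset n) → δ ≤ ∣ p ∣ → outdegree (subsetDigraph δ n) (n ↑ʳ encode p) ≡ ∣ p ∣
outdegree-encode p δ≤ = trans (cong ∣_∣ (out-encode p δ≤)) (∣p++⊥∣≡∣p∣ p)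

minOutdegree : ∀ δ n → HasMinOutdegree (subsetDigraph δ (δ + n)) δ
minOutdegree δ n = bound , δ+n ↑ʳ encode p , trans (outdegree-encode p (≤-reflexive (sym ∣p∣≡δ))) ∣p∣≡δ
  where
  δ+n = δ + n

  p : Subset δ+n
  p = ⊤ {δ} ++ ⊥

  ∣p∣≡δ : ∣ p ∣ ≡ δ
  ∣p∣≡δ = trans (∣p++⊥∣≡∣p∣ (⊤ {δ})) (∣⊤∣≡n δ)

  bound : ∀ v → δ ≤ outdegree (subsetDigraph δ δ+n) v
  bound v with splitAt δ+n v
  ... | inj₂ s = subst (δ ≤_) (sym (∣p++⊥∣≡∣p∣ (enlarge δ (decode δ+n s)))) (∣enlarge∣≥ (decode δ+n s) (m≤m+n δ n))
  ... | inj₁ _ = begin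
    δ                             ≤⟨ m≤m+n δ n ⟩
    δ+n                           ≡⟨ m+n∸n≡m δ+n 1 ⟨
    δ+n + 1 ∸ 1                   ≤⟨ ∸-monoˡ-≤ 1 (+-monoʳ-≤ δ+n (m^n>0 2 δ+n)) ⟩
    δ+n + 2 ^ δ+n ∸ 1             ≡⟨ cong (δ+n + 2 ^ δ+n ∸_) (∣⁅x⁆∣≡1 v) ⟨
    δ+n + 2 ^ δ+n ∸ ∣ ⁅ v ⁆ ∣     ≡⟨ ∣∁p∣≡n∸∣p∣ ⁅ v ⁆ ⟨
    ∣ ∁ ⁅ v ⁆ ∣                   ∎
    where open ≤-Reasoning

monochromatic : ∀ {δ} → k * δ < n → (f : Vertex (subsetDigraph δ n) → Fin k) →
                ∃[ v ] MonochromaticOut (subsetDigraph δ n) f v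
monochromatic {k} {n} {δ} kδ<n f with c , δ<∣S∣ ← large-fibre δ (f ∘ (_↑ˡ 2 ^ n)) kδ<n =
  n ↑ʳ encode S , λ u∈ w∈ → trans (coloured u∈) (sym (coloured w∈))
  where
  S : Subset n
  S = fibre (f ∘ (_↑ˡ 2 ^ n)) c

  coloured : ∀ {u} → u ∈ out (subsetDigraph δ n) (n ↑ʳ encode S) → f u ≡ c
  coloured u∈ with _ , refl , i∈S ← ∈p++⊥ S (subst (_ ∈_) (out-encode S (<⇒≤ δ<∣S∣)) u∈) =
    ∈fibre (f ∘ (_↑ˡ 2 ^ n)) c i∈S

n+2^n-injective : m + 2 ^ m ≡ n + 2 ^ n → m ≡ n
n+2^n-injective {m} {n} eq with <-cmp m n
... | tri≈ _ m≡n _ = m≡n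
... | tri< m<n _ _ = contradiction eq (<⇒≢ (+-mono-<-≤ m<n (^-monoʳ-≤ 2 (<⇒≤ m<n))))
... | tri> _ _ n<m = contradiction (sym eq) (<⇒≢ (+-mono-<-≤ n<m (^-monoʳ-≤ 2 (<⇒≤ n<m))))

lemma5 : ∀ (k δ : ℕ) → k ≥ 1 →
    InfinitelyManyUpToIso (λ G →
    HasMinOutdegree G δ ×
    (∀ (f : Vertex G → Fin k) → ∃[ v ] MonochromaticOut G f v))
lemma5 k δ _ =
  (λ i → subsetDigraph δ (base i)) ,
  (λ i → minOutdegree δ (suc (k * δ + i)) , monochromatic (kδ<base i)) ,
  (λ i j i≢j (φ , _) → i≢j (base-injective (n+2^n-injective (↔⇒≡ φ))))
  where
  base : ℕ → ℕ
  base i = δ + suc (k * δ + i)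

  kδ<base : ∀ i → k * δ < base i
  kδ<base i = ≤-trans (s≤s (m≤m+n (k * δ) i)) (m≤n+m _ δ)

  base-injective : ∀ {i j} → base i ≡ base j → i ≡ j
  base-injective = +-cancelˡ-≡ (k * δ) _ _ ∘ suc-injective ∘ +-cancelˡ-≡ δ _ _
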